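{- Let $p/q\in\mathbb Q\setminus\mathbb Z$ be a rational number in lowest terms, with continued fraction expansion $\mathcal C_1=[a_0;\mathbf a]=[a_0;a_1,\dots,a_{2k}]$ taken with last partial quotient of even index $2k$, and let $(x_n)_{n\ge1}$ be the integer sequence defined by $$x_1=q,\qquad x_{j+1}=x_j^2z_{j+1},\quad j\ge1,$$ where $(z_n)_{n\ge2}$ is an arbitrary sequence of positive integers, subject to the restriction $z_j\ge2$ for all $j\ge2$. With the transformations $\varphi_z$ and $\varphi_z^*$ defined in the context, define a sequence of finite continued fractions by $$\mathcal C_2=\begin{cases}\varphi^*_{z_2}(\mathcal C_1),&\text{if } a_{2k}=1,\\ \varphi_{z_2}(\mathcal C_1),&\text{otherwise,}\end{cases}$$ and, for all $j\ge2$, $$\mathcal C_{j+1}=\begin{cases}\varphi^*_{z_{j+1}}(\mathcal C_j),&\text{if } a_1=1,\\ \varphi_{z_{j+1}}(\mathcal C_j),&\text{otherwise.}\end{cases}$$ Then the modified Engel series $$\alpha=\frac pq+\sum_{j=2}^\infty\frac1{x_j}$$ has continued fraction expansion $\lim_{N\to\infty}\mathcal C_N$.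
   Context: $[a_0;a_1,\dots,a_n]$ denotes the finite continued fraction $a_0+\cfrac1{a_1+\cfrac1{\cdots+\cfrac1{a_n}}}$ with $a_0\in\mathbb Z$ and $a_j\in\mathbb Z_{>0}$ for $j\ge1$. Every rational number has such an expansion whose last index is even, since $[a_0;\dots,a_j]=[a_0;\dots,a_j-1,1]$ if $j=0$ or $a_j>1$, and $[a_0;\dots,a_{j-1},1]=[a_0;\dots,a_{j-1}+1]$. For $n\ge2$, a finite continued fraction $[a_0;\mathbf a]$ with $\mathbf a=(a_1,\dots,a_n)$, and a positive integer $z$, define $$\varphi_z([a_0;\mathbf a])=[a_0;\mathbf a,z-1,\hat{\mathbf a}],\qquad \hat{\mathbf a}=(1,a_n-1,a_{n-1},\dots,a_2,a_1),$$ $$\varphi_z^*([a_0;\mathbf a])=[a_0;\mathbf a,z-1,\mathbf a^*],\qquad \mathbf a^*=(a_{n-1}+1,a_{n-2},\dots,a_2,a_1)$$ (for $n=2$, $\mathbf a^*=(a_1+1)$). Commas denote concatenation of words. The transformation $\varphi_z^*$ is the result of applying $\varphi_z$ to a continued fraction with $a_n=1$ and then removing the resulting zero by the rule $[\dots,A,0,B,\dots]\to[\dots,A+B,\dots]$. The list of partial quotients of $\mathcal C_N$ is an initial segment of that of $\mathcal C_{N+1}$; $\lim_{N\to\infty}\mathcal C_N$ is the infinite continued fraction whose partial quotients extend those of every $\mathcal C_N$.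
   Formalization: The case q = 2 is excluded: there C_1=[a_0;1,1], C_2 ends in 2 although a_1=1, so the printed rule wrongly applies φ* and gives sixth partial quotient z_2≥2 where the true expansion of α has 1; the claim as printed fails for every such p/q. -}

module Defs where

open import Data.Bool using (if_then_else_)
open import Data.Integer using (ℤ; +_; -[1+_])
open import Data.List using (List; []; _∷_; _++_; reverse; head; last; length; applyUpTo)
open import Data.List.Relation.Unary.All using (All)
open import Data.Maybe using (Maybe; just)
open import Data.Maybe.Properties using (≡-dec)
open import Data.Nat as ℕ using (ℕ; zero; suc; _∸_; NonZero)
open import Data.Product using (∃; _×_)
open import Data.Rational using (ℚ; mkℚ; 0ℚ; 1/_; _/_; _+_; _-_; ∣_∣; _<_)
open import Relation.Binary.PropositionalEquality using (_≡_)
open import Relation.Nullary.Decidable using (Dec; does)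

fromℕ : ℕ → ℚ
fromℕ n = + n / 1

-- The value at 0 is a convention (0ℚ); it is only used at positive arguments.
recip : ℚ → ℚ
recip (mkℚ (+ zero) _ _)        = 0ℚ
recip p@(mkℚ (+ suc _) _ _)     = 1/ p
recip p@(mkℚ (-[1+ _ ]) _ _)    = 1/ p

------------------------------------------------------------------------
-- Real numbers as Cauchy sequences of rationals

IsCauchy : (ℕ → ℚ) → Set
IsCauchy s = ∀ ε → 0ℚ < ε → ∃ λ N → ∀ m n → N ℕ.≤ m → N ℕ.≤ n → ∣ s m - s n ∣ < ε

record ℝ : Set where
  field
    approx : ℕ → ℚ
    cauchy : IsCauchy approx

-- Convergence of a rational sequence to a real number.  Since the
-- approximations of α converge to α, bounding ∣ s n - approx α m ∣ for all
-- large m and n is the same as bounding ∣ s n - α ∣ for all large n.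
infix 4 _⟶_
_⟶_ : (ℕ → ℚ) → ℝ → Set
s ⟶ α = ∀ ε → 0ℚ < ε →
  ∃ λ N → ∀ m n → N ℕ.≤ m → N ℕ.≤ n → ∣ s n - ℝ.approx α m ∣ < ε

------------------------------------------------------------------------
-- Continued fractions

-- [ a₀ ⨾ a₁ ∷ … ∷ aₙ ∷ [] ].  Positivity of a₁, …, aₙ is a separate predicate,
-- because φ applied to a fraction with aₙ ≡ 1 has a zero quotient.
infix 5 [_⨾_]
record FiniteCF : Set where
  constructor [_⨾_]
  field
    integerPart : ℤ
    quotients   : List ℕ

open FiniteCF public

Positive : FiniteCF → Set
Positive c = All NonZero (quotients c)

-- fractional (a₁ ∷ … ∷ aₙ ∷ []) = 1/(a₁ + 1/(a₂ + ⋯ + 1/aₙ))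
fractional : List ℕ → ℚ
fractional []      = 0ℚ
fractional (a ∷ w) = recip (fromℕ a + fractional w)

value : FiniteCF → ℚ
value [ a₀ ⨾ w ] = a₀ / 1 + fractional w

-- quotient i is the partial quotient of index i + 1.
record InfiniteCF : Set where
  field
    integerPart : ℤ
    quotient    : ℕ → ℕ
    positive    : ∀ i → NonZero (quotient i)

truncate : InfiniteCF → ℕ → FiniteCF
truncate b n = [ InfiniteCF.integerPart b ⨾ applyUpTo (InfiniteCF.quotient b) n ]

HasExpansion : ℝ → InfiniteCF → Set
HasExpansion α b = (λ n → value (truncate b n)) ⟶ α

-- Every term is an initial segment of b, and the lengths are unbounded, so
-- that b is determined by the sequence.
IsLimit : (ℕ → FiniteCF) → InfiniteCF → Set
IsLimit C b =
  (∀ N → C N ≡ truncate b (length (quotients (C N)))) ×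
  (∀ i → ∃ λ N → i ℕ.< length (quotients (C N)))

------------------------------------------------------------------------
-- The transformations φ and φ*

-- Both words are read off the reversal aₙ ∷ aₙ₋₁ ∷ … ∷ a₁ ∷ [].  They are
-- meant for n ≥ 2; the clauses for shorter words are arbitrary.
hat : List ℕ → List ℕ
hat w with reverse w
... | []     = []
... | aₙ ∷ v = 1 ∷ (aₙ ∸ 1) ∷ v

star : List ℕ → List ℕ
star w with reverse w
... | _ ∷ aₙ₋₁ ∷ v = suc aₙ₋₁ ∷ v
... | _            = []

φ : ℕ → FiniteCF → FiniteCF
φ z [ a₀ ⨾ w ] = [ a₀ ⨾ w ++ (z ∸ 1) ∷ hat w ]

φ* : ℕ → FiniteCF → FiniteCF
φ* z [ a₀ ⨾ w ] = [ a₀ ⨾ w ++ (z ∸ 1) ∷ star w ]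

------------------------------------------------------------------------
-- The sequences xⱼ, 𝒞ⱼ and the partial sums.  Here z j is zⱼ, used for j ≥ 2
-- only, whereas the constructed sequences start at 0: their n-th term has
-- index n + 1.

engel : ℕ → (ℕ → ℕ) → ℕ → ℕ
engel q z zero    = q
engel q z (suc n) = engel q z n ℕ.^ 2 ℕ.* z (2 ℕ.+ n)

-- partialSum s x n = s + 1/x₂ + ⋯ + 1/xₙ₊₁
partialSum : ℚ → (ℕ → ℕ) → ℕ → ℚ
partialSum s x zero    = s
partialSum s x (suc n) = partialSum s x n + recip (fromℕ (x (suc n)))

isOne? : (m : Maybe ℕ) → Dec (m ≡ just 1)
isOne? m = ≡-dec ℕ._≟_ m (just 1)

-- The first step tests the last quotient of c, all later steps test its
-- first quotient a₁.  For j ≥ 2 the last quotient of 𝒞ⱼ is a₁, except when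
-- c = [ a₀ ⨾ a₁ ∷ 1 ∷ [] ], where it is a₁ + 1 for j = 2.
𝒞 : FiniteCF → (ℕ → ℕ) → ℕ → FiniteCF
𝒞 c z zero          = c
𝒞 c z (suc zero)    =
  if does (isOne? (last (quotients c))) then φ* (z 2) c else φ (z 2) c
𝒞 c z (suc (suc n)) =
  if does (isOne? (head (quotients c)))
  then φ* (z (3 ℕ.+ n)) (𝒞 c z (suc n))
  else φ (z (3 ℕ.+ n)) (𝒞 c z (suc n))

{-# OPTIONS --safe #-}
-- Let A = qₙ and B = qₙ₋₁ be the last two continuant denominators of an even-length
-- word w and C = pₙ, D = pₙ₋₁ the corresponding numerators, so that AD − BC = 1.
-- The tail appended after z − 1 has, as a matrix product, the rows (A, C) and
-- (A − B, C − D), both for φ and for φ*: reversal transposes the matrix of w, and the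
-- two tails are the two ways of writing the subtraction of rows by positive quotients.
-- Multiplying out, the new fraction has denominator z A² and numerator z A C + 1, that
-- is, value C/A + 1/(z A²), so the partial sums are the values of the 𝒞ₙ and the xₙ
-- are their denominators.  Every longer truncation of the limit lies within 1/xₙ above
-- the value of 𝒞ₙ, and xₙ tends to infinity.
module Submission where

open import Defs
open import Data.Bool using (true; false; if_then_else_)
open import Data.Empty using (⊥-elim)
open import Data.Integer as ℤ using (ℤ; +_)
import Data.Integer.Divisibility.Signed as ℤ
import Data.Integer.Properties as ℤ
open import Data.List using (List; []; _∷_; _++_; reverse; length; head; last; applyUpTo)
open import Data.List.Properties
  using (unfold-reverse; ++-identityʳ; ++-assoc; reverse-involutive; length-reverse; length-++)
open import Data.List.Relation.Binary.Permutation.Propositional using (↭-sym)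
open import Data.List.Relation.Binary.Permutation.Propositional.Properties using (All-resp-↭; ↭-reverse)
open import Data.List.Relation.Unary.All using (All; []; _∷_)
open import Data.List.Relation.Unary.All.Properties using (++⁺; applyUpTo⁺₂)
open import Data.Maybe using (just)
open import Data.Nat
  using (ℕ; zero; suc; _+_; _*_; _∸_; _^_; _≤_; _<_; _⊔_; z≤n; s≤s; NonZero; >-nonZero; >-nonZero⁻¹)
open import Data.Nat.Coprimality using (Coprime; coprime-divisor; recompute)
  renaming (sym to coprime-sym)
open import Data.Nat.Divisibility
  using (_∣_; divides; ∣-refl; ∣-trans; ∣-antisym; ∣1⇒≡1; ∣m∣n⇒∣m+n; ∣m+n∣m⇒∣n; m∣m*n; n∣m*n)
import Data.Nat.Properties as ℕ
open import Data.Nat.Tactic.RingSolver using (solve-∀)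
open import Data.Product using (∃; ∃₂; _×_; _,_; proj₁; proj₂)
open import Data.Rational as ℚ using (ℚ; mkℚ; 0ℚ; 1ℚ; _/_; ↧ₙ_; NonNegative)
import Data.Rational.Properties as ℚ
open import Data.Rational.Solver using (module +-*-Solver)
import Data.Rational.Unnormalised as ℚᵘ using (*≡*; *<*)
import Data.Rational.Unnormalised.Properties as ℚᵘ
open import Data.Sum using (_⊎_; inj₁; inj₂)
open import Relation.Binary.PropositionalEquality
open import Relation.Nullary.Decidable using (does; dec-false)
open +-*-Solver using (solve; _:=_; _:+_; _:*_; _:-_; :-_; con)

-- Integers and naturals inside the rationals

fromℤ : ℤ → ℚ
fromℤ i = mkℚ i 0 (λ {_} (_ , k∣1) → ∣1⇒≡1 k∣1)

-- `i / 1` does not reduce for a variable `i`; `fromℤ i` is in constructor form, on which rational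
-- arithmetic computes.
/1≡fromℤ : ∀ i → i / 1 ≡ fromℤ i
/1≡fromℤ i = ℚ.↥p/↧p≡p (fromℤ i)

/1-homo-+ : ∀ i j → (i ℤ.+ j) / 1 ≡ i / 1 ℚ.+ j / 1
/1-homo-+ i j rewrite /1≡fromℤ i | /1≡fromℤ j | ℤ.*-identityʳ i | ℤ.*-identityʳ j = refl

/1-homo-* : ∀ i j → (i ℤ.* j) / 1 ≡ i / 1 ℚ.* (j / 1)
/1-homo-* i j rewrite /1≡fromℤ i | /1≡fromℤ j = refl

fromℕ-+ : ∀ m n → fromℕ (m + n) ≡ fromℕ m ℚ.+ fromℕ n
fromℕ-+ m n = /1-homo-+ (+ m) (+ n)

fromℕ-* : ∀ m n → fromℕ (m * n) ≡ fromℕ m ℚ.* fromℕ n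
fromℕ-* m n = trans (cong (_/ 1) (ℤ.pos-* m n)) (/1-homo-* (+ m) (+ n))

fromℕ-mono-≤ : ∀ {m n} → m ≤ n → fromℕ m ℚ.≤ fromℕ n
fromℕ-mono-≤ {m} {n} m≤n rewrite /1≡fromℤ (+ m) | /1≡fromℤ (+ n) =
  ℚ.*≤* (ℤ.*-monoʳ-≤-nonNeg (+ 1) (ℤ.+≤+ m≤n))

fromℕ-nonNeg : ∀ n → NonNegative (fromℕ n)
fromℕ-nonNeg n = ℚ.normalize-nonNeg n 1

fromℕ-pos : ∀ n .{{_ : NonZero n}} → ℚ.Positive (fromℕ n)
fromℕ-pos n = ℚ.normalize-pos n 1

-- Reciprocals and bounds for fractional parts

recip-nonNeg : ∀ p .{{_ : NonNegative p}} → NonNegative (recip p)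
recip-nonNeg (mkℚ (+ zero) _ _)    = _
recip-nonNeg (mkℚ (+ suc _) _ _)   = _

recip-inverseˡ : ∀ p .{{_ : ℚ.Positive p}} → recip p ℚ.* p ≡ 1ℚ
recip-inverseˡ p@(mkℚ (+ suc _) _ _) = ℚ.*-inverseˡ p

fractional-nonNeg : ∀ w → NonNegative (fractional w)
fractional-nonNeg []      = _
fractional-nonNeg (a ∷ w) = recip-nonNeg (fromℕ a ℚ.+ fractional w)
    {{ℚ.nonNeg+nonNeg⇒nonNeg (fromℕ a) {{fromℕ-nonNeg a}} (fractional w) {{fractional-nonNeg w}}}}

-- A positive `a` makes the argument of `recip` positive, away from the conventional value at 0.
fractional-inverse : ∀ a w .{{_ : NonZero a}} →
  fractional (a ∷ w) ℚ.* (fromℕ a ℚ.+ fractional w) ≡ 1ℚ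
fractional-inverse a w =
  recip-inverseˡ (fromℕ a ℚ.+ fractional w)
    {{ℚ.pos+nonNeg⇒pos (fromℕ a) {{fromℕ-pos a}} (fractional w) {{fractional-nonNeg w}}}}

0≤fractional : ∀ w → 0ℚ ℚ.≤ fractional w
0≤fractional w = ℚ.nonNegative⁻¹ (fractional w) {{fractional-nonNeg w}}

-- Multiplying by `a + fractional w`, which is at least 1, can only enlarge `fractional (a ∷ w)`,
-- and the product is 1.
fractional≤1 : ∀ w → All NonZero w → fractional w ℚ.≤ 1ℚ
fractional≤1 []      _                = ℚ.nonNegative⁻¹ 1ℚ
fractional≤1 (a ∷ w) (a≢0 ∷ _) = begin
  fractional (a ∷ w)                                     ≡⟨ sym (ℚ.*-identityʳ _) ⟩
  fractional (a ∷ w) ℚ.* 1ℚ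
    ≤⟨ ℚ.*-monoˡ-≤-nonNeg (fractional (a ∷ w)) {{fractional-nonNeg (a ∷ w)}} 1≤a+w ⟩
  fractional (a ∷ w) ℚ.* (fromℕ a ℚ.+ fractional w)      ≡⟨ fractional-inverse a w {{a≢0}} ⟩
  1ℚ                                                     ∎
  where
  open ℚ.≤-Reasoning
  1≤a+w : 1ℚ ℚ.≤ fromℕ a ℚ.+ fractional w
  1≤a+w = begin
    1ℚ                         ≤⟨ fromℕ-mono-≤ (>-nonZero⁻¹ a {{a≢0}}) ⟩
    fromℕ a                    ≡⟨ sym (ℚ.+-identityʳ _) ⟩
    fromℕ a ℚ.+ 0ℚ             ≤⟨ ℚ.+-monoʳ-≤ (fromℕ a) (0≤fractional w) ⟩
    fromℕ a ℚ.+ fractional w   ∎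

-- Continuants as matrix products

record Matrix : Set where
  constructor mat
  field a₁₁ a₁₂ a₂₁ a₂₂ : ℕ
open Matrix

mat-cong : ∀ {p q r s p′ q′ r′ s′} → p ≡ p′ → q ≡ q′ → r ≡ r′ → s ≡ s′ →
           mat p q r s ≡ mat p′ q′ r′ s′
mat-cong refl refl refl refl = refl

infixl 7 _⊗_
_⊗_ : Matrix → Matrix → Matrix
mat p q r s ⊗ mat p′ q′ r′ s′ =
  mat (p * p′ + q * r′) (p * q′ + q * s′) (r * p′ + s * r′) (r * q′ + s * s′)

transpose : Matrix → Matrix
transpose (mat p q r s) = mat p r q s

-- For convergents pᵢ/qᵢ of fractional w, conv w has the rows (qₙ, qₙ₋₁) and (pₙ, pₙ₋₁).
conv : List ℕ → Matrix
conv []      = mat 1 0 0 1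
conv (a ∷ w) = mat (a * a₁₁ m + a₂₁ m) (a * a₁₂ m + a₂₂ m) (a₁₁ m) (a₁₂ m)
  where m = conv w

-- `conv` is a product of the matrices with rows (a, 1) and (1, 0), one for each quotient.
conv-++ : ∀ u v → conv (u ++ v) ≡ conv u ⊗ conv v
conv-++ []      v = mat-cong (first _) (first _) (second _) (second _)
  where
  first : ∀ n → n ≡ n + 0 + 0
  first = solve-∀
  second : ∀ n → n ≡ n + 0
  second = solve-∀
conv-++ (a ∷ u) v rewrite conv-++ u v = mat-cong (lemma a _ _ _ _ _ _) (lemma a _ _ _ _ _ _) refl refl
  where
  lemma : ∀ a p q r s x y →
    a * (p * x + q * y) + (r * x + s * y) ≡ (a * p + r) * x + (a * q + s) * y
  lemma = solve-∀

-- Each factor is symmetric, so reversing the order of the factors transposes the product.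
conv-reverse : ∀ w → conv (reverse w) ≡ transpose (conv w)
conv-reverse []      = refl
conv-reverse (a ∷ w) rewrite unfold-reverse a w | conv-++ (reverse w) (a ∷ []) | conv-reverse w =
  mat-cong (first a p r) (second a p r) (first a q s) (second a q s)
  where
  open Matrix (conv w) renaming (a₁₁ to p; a₁₂ to q; a₂₁ to r; a₂₂ to s)
  first : ∀ a p q → p * (a * 1 + 0) + q * 1 ≡ a * p + q
  first = solve-∀
  second : ∀ a p q → p * (a * 0 + 1) + q * 0 ≡ p
  second = solve-∀

-- Each factor has determinant -1, so the quotients are removed in pairs. The equation is the
-- determinant identity without subtraction.
conv-unimodular : ∀ w → 2 ∣ length w →
  a₁₁ (conv w) * a₂₂ (conv w) ≡ a₁₂ (conv w) * a₂₁ (conv w) + 1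
conv-unimodular []          _   = refl
conv-unimodular (x ∷ [])    2∣1 with () ← ∣1⇒≡1 2∣1
conv-unimodular (x ∷ y ∷ w) 2∣n = begin
  (x * (y * p + r) + p) * (y * q + s)                           ≡⟨ before x y p q r s ⟩
  common + p * s           ≡⟨ cong (_+_ common) ih ⟩
  common + (q * r + 1)     ≡⟨ after x y p q r s ⟩
  (x * (y * q + s) + q) * (y * p + r) + 1                       ∎
  where
  open ≡-Reasoning
  open Matrix (conv w) renaming (a₁₁ to p; a₁₂ to q; a₂₁ to r; a₂₂ to s)
  common = x * (y * p + r) * (y * q + s) + p * (y * q)
  ih = conv-unimodular w (∣m+n∣m⇒∣n {m = 2} 2∣n ∣-refl)
  before : ∀ x y p q r s → (x * (y * p + r) + p) * (y * q + s) ≡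
    x * (y * p + r) * (y * q + s) + p * (y * q) + p * s
  before = solve-∀
  after : ∀ x y p q r s → x * (y * p + r) * (y * q + s) + p * (y * q) + (q * r + 1) ≡
    (x * (y * q + s) + q) * (y * p + r) + 1
  after = solve-∀

1≤conv : ∀ w → All NonZero w → 1 ≤ a₁₁ (conv w)
1≤conv []      _           = s≤s z≤n
1≤conv (a ∷ w) (a≢0 ∷ w≢0) =
  ℕ.≤-trans (ℕ.*-mono-≤ (>-nonZero⁻¹ a {{a≢0}}) (1≤conv w w≢0)) (ℕ.m≤m+n _ _)

-- The matrix of `u` acts on the value t of the tail by the Möbius transformation t ↦ (C + D t)/(A +
-- B t); the denominator is cleared here.
fractional-++ : ∀ u v → All NonZero u → let mat A B C D = conv u in
  fractional (u ++ v) ℚ.* (fromℕ A ℚ.+ fromℕ B ℚ.* fractional v) ≡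
  fromℕ C ℚ.+ fromℕ D ℚ.* fractional v
fractional-++ []      v _ =
  solve 1 (λ t → t :* (con 1ℚ :+ con 0ℚ :* t) := con 0ℚ :+ con 1ℚ :* t) refl (fractional v)
fractional-++ (a ∷ u) v (a≢0 ∷ u≢0) = begin
  s ℚ.* (fromℕ (a * A + C) ℚ.+ fromℕ (a * B + D) ℚ.* t)
    ≡⟨ cong₂ (λ x y → s ℚ.* (x ℚ.+ y ℚ.* t)) (homo A C) (homo B D) ⟩
  s ℚ.* ((fromℕ a ℚ.* p ℚ.+ r) ℚ.+ (fromℕ a ℚ.* q ℚ.+ r′) ℚ.* t)
    ≡⟨ solve 7 (λ s a p q r r′ t → s :* ((a :* p :+ r) :+ (a :* q :+ r′) :* t) :=
         s :* (a :* (p :+ q :* t) :+ (r :+ r′ :* t))) refl s (fromℕ a) p q r r′ t ⟩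
  s ℚ.* (fromℕ a ℚ.* (p ℚ.+ q ℚ.* t) ℚ.+ (r ℚ.+ r′ ℚ.* t))
    ≡⟨ cong (λ x → s ℚ.* (fromℕ a ℚ.* (p ℚ.+ q ℚ.* t) ℚ.+ x)) (fractional-++ u v u≢0) ⟨
  s ℚ.* (fromℕ a ℚ.* (p ℚ.+ q ℚ.* t) ℚ.+ s′ ℚ.* (p ℚ.+ q ℚ.* t))
    ≡⟨ solve 4 (λ s a s′ d → s :* (a :* d :+ s′ :* d) := s :* (a :+ s′) :* d) refl
         s (fromℕ a) s′ (p ℚ.+ q ℚ.* t) ⟩
  s ℚ.* (fromℕ a ℚ.+ s′) ℚ.* (p ℚ.+ q ℚ.* t)
    ≡⟨ cong (ℚ._* (p ℚ.+ q ℚ.* t)) (fractional-inverse a (u ++ v) {{a≢0}}) ⟩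
  1ℚ ℚ.* (p ℚ.+ q ℚ.* t)
    ≡⟨ ℚ.*-identityˡ _ ⟩
  p ℚ.+ q ℚ.* t ∎
  where
  open ≡-Reasoning
  open Matrix (conv u) renaming (a₁₁ to A; a₁₂ to B; a₂₁ to C; a₂₂ to D)
  t  = fractional v
  s  = fractional (a ∷ u ++ v)
  s′ = fractional (u ++ v)
  p  = fromℕ A
  q  = fromℕ B
  r  = fromℕ C
  r′ = fromℕ D
  homo : ∀ m n → fromℕ (a * m + n) ≡ fromℕ a ℚ.* fromℕ m ℚ.+ fromℕ n
  homo m n = trans (fromℕ-+ (a * m) n) (cong (ℚ._+ fromℕ n) (fromℕ-* a m))

fractional-conv : ∀ w → All NonZero w → let mat A B C D = conv w in
  fractional w ℚ.* fromℕ A ≡ fromℕ C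
fractional-conv w w≢0 = begin
  fractional w ℚ.* fromℕ A
    ≡⟨ cong (fractional w ℚ.*_) (drop-zero A B) ⟨
  fractional w ℚ.* (fromℕ A ℚ.+ fromℕ B ℚ.* 0ℚ)
    ≡⟨ cong (λ u → fractional u ℚ.* (fromℕ A ℚ.+ fromℕ B ℚ.* 0ℚ)) (++-identityʳ w) ⟨
  fractional (w ++ []) ℚ.* (fromℕ A ℚ.+ fromℕ B ℚ.* 0ℚ)
    ≡⟨ fractional-++ w [] w≢0 ⟩
  fromℕ C ℚ.+ fromℕ D ℚ.* 0ℚ
    ≡⟨ drop-zero C D ⟩
  fromℕ C ∎
  where
  open ≡-Reasoning
  open Matrix (conv w) renaming (a₁₁ to A; a₁₂ to B; a₂₁ to C; a₂₂ to D)
  drop-zero : ∀ m n → fromℕ m ℚ.+ fromℕ n ℚ.* 0ℚ ≡ fromℕ m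
  drop-zero m n = trans (cong (fromℕ m ℚ.+_) (ℚ.*-zeroʳ (fromℕ n))) (ℚ.+-identityʳ (fromℕ m))

-- Distance between a word of even length and its extensions

module _ (u v : List ℕ) (u≢0 : All NonZero u) (v≢0 : All NonZero v) (2∣u : 2 ∣ length u) where
  open Matrix (conv u) renaming (a₁₁ to A; a₁₂ to B; a₂₁ to C; a₂₂ to D)

  private
    s = fractional (u ++ v)
    s₀ = fractional u
    t = fractional v
    A+Bt = fromℕ A ℚ.+ fromℕ B ℚ.* t

    -- With s = (C + D t)/(A + B t) and s₀ = C/A, the difference has numerator (A D - B C) t, and
    -- the determinant is 1 by even length.
    tail-contribution : (s ℚ.- s₀) ℚ.* (fromℕ A ℚ.* A+Bt) ≡ t
    tail-contribution = begin
      (s ℚ.- s₀) ℚ.* (fromℕ A ℚ.* A+Bt)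
        ≡⟨ solve 4 (λ s s₀ a d → (s :- s₀) :* (a :* d) := a :* (s :* d) :- s₀ :* a :* d)
             refl s s₀ (fromℕ A) A+Bt ⟩
      fromℕ A ℚ.* (s ℚ.* A+Bt) ℚ.- s₀ ℚ.* fromℕ A ℚ.* A+Bt
        ≡⟨ cong₂ (λ x y → fromℕ A ℚ.* x ℚ.- y ℚ.* A+Bt) (fractional-++ u v u≢0) (fractional-conv u u≢0) ⟩
      fromℕ A ℚ.* (fromℕ C ℚ.+ fromℕ D ℚ.* t) ℚ.- fromℕ C ℚ.* A+Bt
        ≡⟨ solve 5 (λ a b c d t → a :* (c :+ d :* t) :- c :* (a :+ b :* t) := (a :* d :- b :* c) :* t)
             refl (fromℕ A) (fromℕ B) (fromℕ C) (fromℕ D) t ⟩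
      (fromℕ A ℚ.* fromℕ D ℚ.- fromℕ B ℚ.* fromℕ C) ℚ.* t
        ≡⟨ cong (λ x → (x ℚ.- fromℕ B ℚ.* fromℕ C) ℚ.* t) unimodular ⟩
      (fromℕ B ℚ.* fromℕ C ℚ.+ 1ℚ ℚ.- fromℕ B ℚ.* fromℕ C) ℚ.* t
        ≡⟨ solve 2 (λ x t → (x :+ con 1ℚ :- x) :* t := t) refl (fromℕ B ℚ.* fromℕ C) t ⟩
      t ∎
      where
      open ≡-Reasoning
      unimodular : fromℕ A ℚ.* fromℕ D ≡ fromℕ B ℚ.* fromℕ C ℚ.+ 1ℚ
      unimodular = begin
        fromℕ A ℚ.* fromℕ D         ≡⟨ fromℕ-* A D ⟨
        fromℕ (A * D)               ≡⟨ cong fromℕ (conv-unimodular u 2∣u) ⟩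
        fromℕ (B * C + 1)           ≡⟨ fromℕ-+ (B * C) 1 ⟩
        fromℕ (B * C) ℚ.+ 1ℚ        ≡⟨ cong (ℚ._+ 1ℚ) (fromℕ-* B C) ⟩
        fromℕ B ℚ.* fromℕ C ℚ.+ 1ℚ  ∎

    1≤A : 1ℚ ℚ.≤ fromℕ A
    1≤A = fromℕ-mono-≤ (1≤conv u u≢0)

    A≤A*A+Bt : fromℕ A ℚ.≤ fromℕ A ℚ.* A+Bt
    A≤A*A+Bt = begin
      fromℕ A           ≡⟨ ℚ.*-identityʳ (fromℕ A) ⟨
      fromℕ A ℚ.* 1ℚ    ≤⟨ ℚ.*-monoˡ-≤-nonNeg (fromℕ A) {{fromℕ-nonNeg A}} 1≤A+Bt ⟩
      fromℕ A ℚ.* A+Bt  ∎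
      where
      open ℚ.≤-Reasoning
      0≤Bt : 0ℚ ℚ.≤ fromℕ B ℚ.* t
      0≤Bt = ℚ.nonNegative⁻¹ _
        {{ℚ.nonNeg*nonNeg⇒nonNeg (fromℕ B) {{fromℕ-nonNeg B}} t {{fractional-nonNeg v}}}}
      1≤A+Bt : 1ℚ ℚ.≤ A+Bt
      1≤A+Bt = begin
        1ℚ             ≤⟨ 1≤A ⟩
        fromℕ A        ≡⟨ ℚ.+-identityʳ (fromℕ A) ⟨
        fromℕ A ℚ.+ 0ℚ ≤⟨ ℚ.+-monoʳ-≤ (fromℕ A) 0≤Bt ⟩
        A+Bt           ∎

  -- By `tail-contribution` the difference has the sign of t, the other factor being positive.
  fractional-++-lower : 0ℚ ℚ.≤ s ℚ.- s₀
  fractional-++-lower = ℚ.*-cancelʳ-≤-pos (fromℕ A ℚ.* A+Bt) {{pos}} (begin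
    0ℚ ℚ.* (fromℕ A ℚ.* A+Bt)          ≡⟨ ℚ.*-zeroˡ (fromℕ A ℚ.* A+Bt) ⟩
    0ℚ                                 ≤⟨ 0≤fractional v ⟩
    t                                  ≡⟨ tail-contribution ⟨
    (s ℚ.- s₀) ℚ.* (fromℕ A ℚ.* A+Bt)  ∎)
    where
    open ℚ.≤-Reasoning
    pos : ℚ.Positive (fromℕ A ℚ.* A+Bt)
    pos = ℚ.positive (ℚ.<-≤-trans (ℚ.positive⁻¹ 1ℚ) (ℚ.≤-trans 1≤A A≤A*A+Bt))

  -- Enlarging the factor A to A (A + B t) turns the product into t, which is at most 1.
  fractional-++-upper : (s ℚ.- s₀) ℚ.* fromℕ A ℚ.≤ 1ℚ
  fractional-++-upper = begin
    (s ℚ.- s₀) ℚ.* fromℕ A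
      ≤⟨ ℚ.*-monoˡ-≤-nonNeg (s ℚ.- s₀) {{ℚ.nonNegative fractional-++-lower}} A≤A*A+Bt ⟩
    (s ℚ.- s₀) ℚ.* (fromℕ A ℚ.* A+Bt)  ≡⟨ tail-contribution ⟩
    t                                  ≤⟨ fractional≤1 v v≢0 ⟩
    1ℚ                                 ∎
    where open ℚ.≤-Reasoning

-- Continuants as denominators in lowest terms

↧ₙ-unique : ∀ (r : ℚ) n (i : ℤ) → r ℚ.* fromℕ n ≡ i / 1 → Coprime ℤ.∣ i ∣ n → ↧ₙ r ≡ n
↧ₙ-unique r@(mkℚ a d-1 a⊥d) n i rn≡i i⊥n =
  -- Both a/d and i/n are in lowest terms, so the cross-multiplied equality makes each denominator
  -- divide the other.
  ∣-antisym (coprime-divisor (coprime-sym (recompute a⊥d)) (divides ℤ.∣ i ∣ an≡id))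
            (coprime-divisor (coprime-sym i⊥n) (divides ℤ.∣ a ∣ (sym an≡id)))
  where
  an≡id : ℤ.∣ a ∣ * n ≡ ℤ.∣ i ∣ * suc d-1
  an≡id = begin
    ℤ.∣ a ∣ * n                         ≡⟨ ℤ.abs-* a (+ n) ⟨
    ℤ.∣ a ℤ.* + n ∣                     ≡⟨ cong ℤ.∣_∣ (ℤ.*-identityʳ (a ℤ.* + n)) ⟨
    ℤ.∣ a ℤ.* + n ℤ.* + 1 ∣             ≡⟨ cong ℤ.∣_∣ cross ⟩
    ℤ.∣ i ℤ.* + (suc d-1 * 1) ∣         ≡⟨ ℤ.abs-* i (+ (suc d-1 * 1)) ⟩
    ℤ.∣ i ∣ * (suc d-1 * 1)             ≡⟨ cong (ℤ.∣ i ∣ *_) (ℕ.*-identityʳ (suc d-1)) ⟩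
    ℤ.∣ i ∣ * suc d-1                   ∎
    where
    open ≡-Reasoning
    rn≡i′ : r ℚ.* fromℤ (+ n) ≡ fromℤ i
    rn≡i′ = trans (cong (r ℚ.*_) (sym (/1≡fromℤ (+ n)))) (trans rn≡i (/1≡fromℤ i))
    -- In unnormalised form the denominators 1 of `fromℤ (+ n)` and `fromℤ i` remain visible.
    cross : a ℤ.* + n ℤ.* + 1 ≡ i ℤ.* + (suc d-1 * 1)
    cross with ℚᵘ.≃-trans (ℚᵘ.≃-sym (ℚ.toℚᵘ-homo-* r (fromℤ (+ n)))) (ℚ.toℚᵘ-cong rn≡i′)
    ... | ℚᵘ.*≡* eq = eq

-- The value is (a₀ A + C)/A. A common divisor of numerator and denominator divides A and C, hence
-- also A D - B C = 1.
↧ₙ-value : ∀ c → Positive c → 2 ∣ length (quotients c) →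
  ↧ₙ value c ≡ a₁₁ (conv (quotients c))
↧ₙ-value c@([ a₀ ⨾ w ]) w≢0 2∣w = ↧ₙ-unique (value c) A (a₀ ℤ.* + A ℤ.+ + C) product coprime
  where
  open Matrix (conv w) renaming (a₁₁ to A; a₁₂ to B; a₂₁ to C; a₂₂ to D)
  open ≡-Reasoning
  product : value c ℚ.* fromℕ A ≡ (a₀ ℤ.* + A ℤ.+ + C) / 1
  product = begin
    (a₀ / 1 ℚ.+ fractional w) ℚ.* fromℕ A
      ≡⟨ ℚ.*-distribʳ-+ (fromℕ A) (a₀ / 1) (fractional w) ⟩
    a₀ / 1 ℚ.* fromℕ A ℚ.+ fractional w ℚ.* fromℕ A
      ≡⟨ cong₂ ℚ._+_ (sym (/1-homo-* a₀ (+ A))) (fractional-conv w w≢0) ⟩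
    (a₀ ℤ.* + A) / 1 ℚ.+ (+ C) / 1
      ≡⟨ /1-homo-+ (a₀ ℤ.* + A) (+ C) ⟨
    (a₀ ℤ.* + A ℤ.+ + C) / 1 ∎
  coprime : Coprime ℤ.∣ a₀ ℤ.* + A ℤ.+ + C ∣ A
  coprime {k} (k∣i , k∣A) = ∣1⇒≡1 (∣m+n∣m⇒∣n {m = B * C}
    (subst (k ∣_) (conv-unimodular w 2∣w) (∣-trans k∣A (m∣m*n D)))
    (∣-trans k∣C (n∣m*n B)))
    where
    k∣C : k ∣ C
    k∣C = ℤ.∣⇒∣ᵤ (ℤ.∣m+n∣m⇒∣n {m = a₀ ℤ.* + A}
      (ℤ.∣ᵤ⇒∣ {+ k} k∣i) (ℤ.∣n⇒∣m*n a₀ (ℤ.∣ᵤ⇒∣ {+ k} {+ A} k∣A)))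

-- Reversal, the two kinds of tail and their matrices

last-++-∷ : ∀ (u : List ℕ) a v → last (u ++ a ∷ v) ≡ last (a ∷ v)
last-++-∷ []          a v = refl
last-++-∷ (x ∷ [])    a v = refl
last-++-∷ (x ∷ y ∷ u) a v = last-++-∷ (y ∷ u) a v

last-reverse : ∀ (w : List ℕ) → last (reverse w) ≡ head w
last-reverse []      = refl
last-reverse (a ∷ w) = trans (cong last (unfold-reverse a w)) (last-++-∷ (reverse w) a [])

last≡head-reverse : ∀ (w : List ℕ) → last w ≡ head (reverse w)
last≡head-reverse w = trans (cong last (sym (reverse-involutive w))) (last-reverse (reverse w))

infix 4 _FoldsTo_
-- The words `hat w` and `star w`, each restricted to the last quotients for which it is meant: at
-- least 2 for `hat`, so that aₙ - 1 is positive, and exactly 1 for `star`.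
data _FoldsTo_ (w : List ℕ) : List ℕ → Set where
  hatted  : ∀ {a b v} → reverse w ≡ suc (suc a) ∷ b ∷ v → w FoldsTo 1 ∷ suc a ∷ b ∷ v
  starred : ∀ {b v} → reverse w ≡ 1 ∷ b ∷ v → w FoldsTo suc b ∷ v

-- The second row of conv t is the difference of the rows of the transpose of conv w;
-- it is stated without subtraction.
foldsTo-conv : ∀ {w t} → w FoldsTo t → let mat A B C D = conv w; mat A′ C′ E F = conv t in
  A′ ≡ A × C′ ≡ C × E + B ≡ A × F + D ≡ C
foldsTo-conv {w} {t} folds = go folds
  where
  conv-w : ∀ {u} → reverse w ≡ u → conv w ≡ transpose (conv u)
  conv-w refl = sym (cong transpose (conv-reverse w))
  shuffle₁ : ∀ m p r → m + r + 0 + p ≡ p + m + r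
  shuffle₁ = solve-∀
  shuffle₂ : ∀ m p r → m + r + p ≡ p + m + r
  shuffle₂ = solve-∀
  shuffle₃ : ∀ m p r → p + (m + r) ≡ m + r + 0 + p
  shuffle₃ = solve-∀
  go : w FoldsTo t → let mat A B C D = conv w; mat A′ C′ E F = conv t in
    A′ ≡ A × C′ ≡ C × E + B ≡ A × F + D ≡ C
  go (hatted {a} {b} {v} eq) rewrite conv-w eq =
    shuffle₁ (suc a * p) p r , shuffle₁ (suc a * q) q s ,
    shuffle₂ (suc a * p) p r , shuffle₂ (suc a * q) q s
    where open Matrix (conv (b ∷ v)) renaming (a₁₁ to p; a₁₂ to q; a₂₁ to r; a₂₂ to s)
  go (starred {b} {v} eq) rewrite conv-w eq =
    sym (shuffle₁ (b * p) p r) , sym (shuffle₁ (b * q) q s) ,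
    shuffle₃ (b * p) p r , shuffle₃ (b * q) q s
    where open Matrix (conv v) renaming (a₁₁ to p; a₁₂ to q; a₂₁ to r; a₂₂ to s)

module _ {w t} (z : ℕ) (folds : w FoldsTo t) where
  open Matrix (conv w) renaming (a₁₁ to A; a₁₂ to B; a₂₁ to C; a₂₂ to D)
  private
    module T = Matrix (conv t)
    E = T.a₂₁

  -- Here `z` is the middle quotient, one less than the parameter of the transformation, hence
  -- `suc z`. The entries E of the tail and B of `w` add up to A, which supplies the extra A².
  fold-denominator : a₁₁ (conv (w ++ z ∷ t)) ≡ A ^ 2 * suc z
  fold-denominator with p , _ , r , _ ← foldsTo-conv folds = begin
    a₁₁ (conv (w ++ z ∷ t))               ≡⟨ cong a₁₁ (conv-++ w (z ∷ t)) ⟩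
    A * (z * T.a₁₁ + E) + B * T.a₁₁       ≡⟨ cong (λ x → A * (z * x + E) + B * x) p ⟩
    A * (z * A + E) + B * A               ≡⟨ collect A B E z ⟩
    A * (z * A) + A * (E + B)             ≡⟨ cong (λ x → A * (z * A) + A * x) r ⟩
    A * (z * A) + A * A                   ≡⟨ finish A z ⟩
    A ^ 2 * suc z                         ∎
    where
    open ≡-Reasoning
    collect : ∀ A B E z → A * (z * A + E) + B * A ≡ A * (z * A) + A * (E + B)
    collect = solve-∀
    finish : ∀ A z → A * (z * A) + A * A ≡ A * (A * 1) * (1 + z)
    finish = solve-∀

  -- The expansion is that of the denominator with the row (C, D). The determinant replaces A D by B
  -- C + 1, and this 1 becomes the numerator of the new term of the series.
  fold-numerator : 2 ∣ length w → a₂₁ (conv (w ++ z ∷ t)) ≡ C * A * suc z + 1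
  fold-numerator 2∣w with p , _ , r , _ ← foldsTo-conv folds = begin
    a₂₁ (conv (w ++ z ∷ t))               ≡⟨ cong a₂₁ (conv-++ w (z ∷ t)) ⟩
    C * (z * T.a₁₁ + E) + D * T.a₁₁       ≡⟨ cong (λ x → C * (z * x + E) + D * x) p ⟩
    C * (z * A + E) + D * A               ≡⟨ expand A C D E z ⟩
    C * (z * A) + C * E + A * D           ≡⟨ cong (_+_ (C * (z * A) + C * E)) (conv-unimodular w 2∣w) ⟩
    C * (z * A) + C * E + (B * C + 1)     ≡⟨ collect A B C E z ⟩
    C * (z * A) + C * (E + B) + 1         ≡⟨ cong (λ x → C * (z * A) + C * x + 1) r ⟩
    C * (z * A) + C * A + 1               ≡⟨ finish A C z ⟩
    C * A * suc z + 1                     ∎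
    where
    open ≡-Reasoning
    expand : ∀ A C D E z → C * (z * A + E) + D * A ≡ C * (z * A) + C * E + A * D
    expand = solve-∀
    collect : ∀ A B C E z → C * (z * A) + C * E + (B * C + 1) ≡ C * (z * A) + C * (E + B) + 1
    collect = solve-∀
    finish : ∀ A C z → C * (z * A) + C * A + 1 ≡ C * A * (1 + z) + 1
    finish = solve-∀

-- The value of a folded fraction

*-cancelʳ-pos : ∀ {p q} r .{{_ : ℚ.Positive r}} → p ℚ.* r ≡ q ℚ.* r → p ≡ q
*-cancelʳ-pos r eq = ℚ.≤-antisym (ℚ.*-cancelʳ-≤-pos r (ℚ.≤-reflexive eq))
                                 (ℚ.*-cancelʳ-≤-pos r (ℚ.≤-reflexive (sym eq)))

conv-nonZero : ∀ w → All NonZero w → NonZero (a₁₁ (conv w))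
conv-nonZero w w≢0 = >-nonZero (1≤conv w w≢0)

-- After multiplication by the new denominator X = A · A (z + 1), the right side becomes C A (z + 1)
-- + 1, the new numerator.
fractional-fold : ∀ {w t} z → w FoldsTo t → 2 ∣ length w →
  All NonZero w → All NonZero (w ++ z ∷ t) →
  fractional (w ++ z ∷ t) ≡ fractional w ℚ.+ recip (fromℕ (a₁₁ (conv (w ++ z ∷ t))))
fractional-fold {w} {t} z folds 2∣w w≢0 w′≢0 = *-cancelʳ-pos X {{X-pos}} (begin
  fractional (w ++ z ∷ t) ℚ.* X
    ≡⟨ fractional-conv (w ++ z ∷ t) w′≢0 ⟩
  fromℕ (a₂₁ (conv (w ++ z ∷ t)))
    ≡⟨ cong fromℕ (fold-numerator z folds 2∣w) ⟩
  fromℕ (C * A * suc z + 1)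
    ≡⟨ fromℕ-+ (C * A * suc z) 1 ⟩
  fromℕ (C * A * suc z) ℚ.+ 1ℚ
    ≡⟨ cong (λ x → fromℕ x ℚ.+ 1ℚ) (ℕ.*-assoc C A (suc z)) ⟩
  fromℕ (C * (A * suc z)) ℚ.+ 1ℚ
    ≡⟨ cong (ℚ._+ 1ℚ) (fromℕ-* C (A * suc z)) ⟩
  fromℕ C ℚ.* fromℕ (A * suc z) ℚ.+ 1ℚ
    ≡⟨ cong (λ x → x ℚ.* fromℕ (A * suc z) ℚ.+ 1ℚ) (fractional-conv w w≢0) ⟨
  s ℚ.* fromℕ A ℚ.* fromℕ (A * suc z) ℚ.+ 1ℚ
    ≡⟨ cong (ℚ._+ 1ℚ) (ℚ.*-assoc s (fromℕ A) (fromℕ (A * suc z))) ⟩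
  s ℚ.* (fromℕ A ℚ.* fromℕ (A * suc z)) ℚ.+ 1ℚ
    ≡⟨ cong (λ x → s ℚ.* x ℚ.+ 1ℚ) X-split ⟨
  s ℚ.* X ℚ.+ 1ℚ
    ≡⟨ cong (s ℚ.* X ℚ.+_) (recip-inverseˡ X {{X-pos}}) ⟨
  s ℚ.* X ℚ.+ recip X ℚ.* X
    ≡⟨ ℚ.*-distribʳ-+ X s (recip X) ⟨
  (s ℚ.+ recip X) ℚ.* X ∎)
  where
  open ≡-Reasoning
  open Matrix (conv w) renaming (a₁₁ to A; a₁₂ to B; a₂₁ to C; a₂₂ to D)
  s = fractional w
  X = fromℕ (a₁₁ (conv (w ++ z ∷ t)))
  X-pos : ℚ.Positive X
  X-pos = fromℕ-pos _ {{conv-nonZero (w ++ z ∷ t) w′≢0}}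
  regroup : ∀ A z → A * (A * 1) * (1 + z) ≡ A * (A * (1 + z))
  regroup = solve-∀
  X-split : X ≡ fromℕ A ℚ.* fromℕ (A * suc z)
  X-split = trans (cong fromℕ (trans (fold-denominator z folds) (regroup A z))) (fromℕ-* A (A * suc z))

-- Words that can be folded repeatedly

hat-reverse : ∀ w {a v} → reverse w ≡ a ∷ v → hat w ≡ 1 ∷ (a ∸ 1) ∷ v
hat-reverse w eq rewrite eq = refl

star-reverse : ∀ w {a b v} → reverse w ≡ a ∷ b ∷ v → star w ≡ suc b ∷ v
star-reverse w eq rewrite eq = refl

record Admissible (w : List ℕ) : Set where
  field
    positive : All NonZero w
    even     : 2 ∣ length w
    long     : 2 ≤ length w
    -- [ 1 , 1 ] is the only word whose φ*-fold ends in 2 although a₁ ≡ 1.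
    notOnes  : w ≢ 1 ∷ 1 ∷ []
open Admissible

-- The last quotient decides at every step, since it determines which tail is positive; `𝒞` tests a₁
-- from the second step on.
foldTail : List ℕ → List ℕ
foldTail w = if does (isOne? (last w)) then star w else hat w

reverse-positive : ∀ {w} → All NonZero w → All NonZero (reverse w)
reverse-positive {w} = All-resp-↭ (↭-sym (↭-reverse w))

foldsTo : ∀ w → Admissible w → w FoldsTo foldTail w
foldsTo w adm rewrite last≡head-reverse w = go (reverse w) refl
  where
  go : ∀ r → reverse w ≡ r →
       w FoldsTo (if does (isOne? (head (reverse w))) then star w else hat w)
  go [] eq with () ← subst (2 ≤_) (trans (sym (length-reverse w)) (cong length eq)) (long adm)
  go (a ∷ []) eq with s≤s () ← subst (2 ≤_) (trans (sym (length-reverse w)) (cong length eq)) (long adm)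
  go (zero ∷ b ∷ v) eq with () ∷ _ ← subst (All NonZero) eq (reverse-positive (positive adm))
  go (suc zero ∷ b ∷ v) eq rewrite star-reverse w eq | eq = starred eq
  go (suc (suc a) ∷ b ∷ v) eq rewrite hat-reverse w eq | eq = hatted eq

foldWord : ℕ → List ℕ → List ℕ
foldWord z w = w ++ (z ∸ 1) ∷ foldTail w

foldsTo-positive : ∀ {w t} → w FoldsTo t → All NonZero w → All NonZero t
foldsTo-positive (hatted eq) w≢0 with _ ∷ v≢0 ← subst (All NonZero) eq (reverse-positive w≢0) =
  _ ∷ _ ∷ v≢0
foldsTo-positive (starred eq) w≢0 with _ ∷ _ ∷ v≢0 ← subst (All NonZero) eq (reverse-positive w≢0) =
  _ ∷ v≢0

-- The hatted tail is one longer than `w` and the starred tail one shorter; the middle quotient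
-- restores even length.
foldsTo-odd : ∀ {w t} → w FoldsTo t → 2 ∣ length w → 2 ∣ suc (length t)
foldsTo-odd {w} (hatted eq) 2∣w =
  ∣m∣n⇒∣m+n {m = 2} ∣-refl (subst (2 ∣_) (trans (sym (length-reverse w)) (cong length eq)) 2∣w)
foldsTo-odd {w} (starred eq) 2∣w =
  subst (2 ∣_) (trans (sym (length-reverse w)) (cong length eq)) 2∣w

foldWord-admissible : ∀ {w} z → 2 ≤ z → Admissible w → Admissible (foldWord z w)
foldWord-admissible {w} z 2≤z adm = record
  -- The bound `2 ≤ z` makes the middle quotient `z ∸ 1` positive.
  { positive = ++⁺ (positive adm) (>-nonZero (ℕ.∸-monoˡ-≤ 1 2≤z) ∷ foldsTo-positive folds (positive adm))
  ; even     = subst (2 ∣_) (sym (length-++ w)) (∣m∣n⇒∣m+n (even adm) (foldsTo-odd folds (even adm)))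
  ; long     = ℕ.≤-trans (long adm) (subst (length w ≤_) (sym (length-++ w)) (ℕ.m≤m+n (length w) _))
  ; notOnes  = longer w (long adm)
  }
  where
  folds = foldsTo w adm
  longer : ∀ u {a v} → 2 ≤ length u → u ++ a ∷ v ≢ 1 ∷ 1 ∷ []
  longer (_ ∷ [])        (s≤s ())
  longer (_ ∷ _ ∷ [])    _ ()
  longer (_ ∷ _ ∷ _ ∷ _) _ ()

-- A tail with more than one quotient ends like the reversal of `w`, that is, in a₁.
foldsTo-last : ∀ {w t} → w FoldsTo t → Admissible w →
  does (isOne? (last t)) ≡ does (isOne? (head w))
foldsTo-last {w} (hatted eq) adm
  rewrite sym (last-reverse w) | eq = refl
foldsTo-last {w} (starred {b} {c ∷ v} eq) adm
  rewrite sym (last-reverse w) | eq = refl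
-- Here `w` is `b ∷ 1 ∷ []` and the tail is the single quotient `suc b`. Both tests fail: `b` is not
-- 0 by positivity and not 1 by `notOnes`.
foldsTo-last {w} (starred {b} {[]} eq) adm
  with refl ← trans (sym (reverse-involutive w)) (cong reverse eq) =
  trans (dec-false (isOne? (just (suc b))) sucb≢1) (sym (dec-false (isOne? (just b)) b≢1))
  where
  sucb≢1 : just (suc b) ≢ just 1
  sucb≢1 refl with () ∷ _ ← positive adm
  b≢1 : just b ≢ just 1
  b≢1 refl = notOnes adm refl

foldWord-last : ∀ {w} z → Admissible w →
  does (isOne? (last (foldWord z w))) ≡ does (isOne? (head w))
foldWord-last {w} z adm = trans
  (cong (λ m → does (isOne? m)) (go (foldsTo w adm)))
  (foldsTo-last (foldsTo w adm) adm)
  where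
  go : ∀ {t} → w FoldsTo t → last (w ++ (z ∸ 1) ∷ t) ≡ last t
  -- The case split only exposes that the tail is nonempty.
  go (hatted _)  = last-++-∷ w _ _
  go (starred _) = last-++-∷ w _ _

-- The limit of a chain of growing words

quotientAt : List ℕ → ℕ → ℕ
-- The default 1 keeps every entry nonzero, as `positive` in `InfiniteCF` demands.
quotientAt []      _       = 1
quotientAt (a ∷ w) zero    = a
quotientAt (a ∷ w) (suc i) = quotientAt w i

quotientAt-++ˡ : ∀ u v {i} → i < length u → quotientAt (u ++ v) i ≡ quotientAt u i
quotientAt-++ˡ (a ∷ u) v {zero}  _         = refl
quotientAt-++ˡ (a ∷ u) v {suc i} (s≤s i<u) = quotientAt-++ˡ u v i<u

quotientAt-positive : ∀ {w} → All NonZero w → ∀ i → NonZero (quotientAt w i)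
quotientAt-positive []          _       = _
quotientAt-positive (a≢0 ∷ w≢0) zero    = a≢0
quotientAt-positive (a≢0 ∷ w≢0) (suc i) = quotientAt-positive w≢0 i

applyUpTo-quotientAt : ∀ w f → (∀ {i} → i < length w → quotientAt w i ≡ f i) →
  w ≡ applyUpTo f (length w)
applyUpTo-quotientAt []      f eq = refl
applyUpTo-quotientAt (a ∷ w) f eq =
  cong₂ _∷_ (eq (s≤s z≤n)) (applyUpTo-quotientAt w (λ i → f (suc i)) (λ i<w → eq (s≤s i<w)))

applyUpTo-+ : ∀ (f : ℕ → ℕ) m n →
  applyUpTo f (m + n) ≡ applyUpTo f m ++ applyUpTo (λ i → f (m + i)) n
applyUpTo-+ f zero    n = refl
applyUpTo-+ f (suc m) n = cong (f 0 ∷_) (applyUpTo-+ (λ i → f (suc i)) m n)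

module Limit (a₀ : ℤ) (w : ℕ → List ℕ) (w≢0 : ∀ n → All NonZero (w n))
  (extends : ∀ n → ∃₂ λ a v → w (suc n) ≡ w n ++ a ∷ v) where

  prefix : ∀ k n → ∃ λ v → w (k + n) ≡ w n ++ v
  prefix zero    n = [] , sym (++-identityʳ (w n))
  prefix (suc k) n with v , eq ← prefix k n | a , v′ , eq′ ← extends (k + n) =
    v ++ a ∷ v′ , trans eq′ (trans (cong (_++ a ∷ v′) eq) (++-assoc (w n) v (a ∷ v′)))

  length-mono : ∀ {m n} → m ≤ n → length (w m) ≤ length (w n)
  length-mono {m} {n} m≤n with v , eq ← prefix (n ∸ m) m = begin
    length (w m)             ≤⟨ ℕ.m≤m+n (length (w m)) (length v) ⟩
    length (w m) + length v  ≡⟨ length-++ (w m) ⟨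
    length (w m ++ v)        ≡⟨ cong length eq ⟨
    length (w (n ∸ m + m))   ≡⟨ cong (λ k → length (w k)) (ℕ.m∸n+n≡m m≤n) ⟩
    length (w n)             ∎
    where open ℕ.≤-Reasoning

  n≤length : ∀ n → n ≤ length (w n)
  n≤length zero    = z≤n
  n≤length (suc n) with a , v , eq ← extends n = begin
    suc n                            ≤⟨ s≤s (n≤length n) ⟩
    suc (length (w n))               ≤⟨ s≤s (ℕ.m≤m+n (length (w n)) (length v)) ⟩
    suc (length (w n) + length v)    ≡⟨ ℕ.+-suc (length (w n)) (length v) ⟨
    length (w n) + length (a ∷ v)    ≡⟨ length-++ (w n) ⟨
    length (w n ++ a ∷ v)            ≡⟨ cong length eq ⟨
    length (w (suc n))               ∎
    where open ℕ.≤-Reasoning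

  -- Both words are initial segments of `w (m + n)`.
  quotientAt-limit : ∀ m n {i} → i < length (w m) → i < length (w n) →
    quotientAt (w m) i ≡ quotientAt (w n) i
  quotientAt-limit m n {i} i<m i<n with u , eq ← prefix n m | v , eq′ ← prefix m n = begin
    quotientAt (w m) i         ≡⟨ quotientAt-++ˡ (w m) u i<m ⟨
    quotientAt (w m ++ u) i    ≡⟨ cong (λ x → quotientAt x i) eq ⟨
    quotientAt (w (n + m)) i   ≡⟨ cong (λ k → quotientAt (w k) i) (ℕ.+-comm n m) ⟩
    quotientAt (w (m + n)) i   ≡⟨ cong (λ x → quotientAt x i) eq′ ⟩
    quotientAt (w n ++ v) i    ≡⟨ quotientAt-++ˡ (w n) v i<n ⟩
    quotientAt (w n) i         ∎
    where open ≡-Reasoning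

  limit : InfiniteCF
  limit = record
    { integerPart = a₀
    -- Every step adds at least one quotient, so `w (suc i)` reaches beyond index `i`.
    ; quotient    = λ i → quotientAt (w (suc i)) i
    ; positive    = λ i → quotientAt-positive (w≢0 (suc i)) i
    }
  open InfiniteCF limit using (quotient)

  w≡applyUpTo : ∀ n → w n ≡ applyUpTo quotient (length (w n))
  w≡applyUpTo n = applyUpTo-quotientAt (w n) quotient
    (λ {i} i<n → quotientAt-limit n (suc i) i<n (n≤length (suc i)))

  limit-isLimit : IsLimit (λ n → [ a₀ ⨾ w n ]) limit
  limit-isLimit = (λ n → cong [ a₀ ⨾_] (w≡applyUpTo n)) , λ i → suc i , n≤length (suc i)

  truncate-beyond : ∀ n {i} → length (w n) ≤ i →
    ∃ λ v → All NonZero v × truncate limit i ≡ [ a₀ ⨾ w n ++ v ]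
  truncate-beyond n {i} n≤i =
    applyUpTo f (i ∸ length (w n)) ,
    applyUpTo⁺₂ f (i ∸ length (w n)) (λ j → InfiniteCF.positive limit (length (w n) + j)) ,
    cong [ a₀ ⨾_] (begin
      applyUpTo quotient i
        ≡⟨ cong (applyUpTo quotient) (ℕ.m+[n∸m]≡n n≤i) ⟨
      applyUpTo quotient (length (w n) + (i ∸ length (w n)))
        ≡⟨ applyUpTo-+ quotient (length (w n)) (i ∸ length (w n)) ⟩
      applyUpTo quotient (length (w n)) ++ applyUpTo f (i ∸ length (w n))
        ≡⟨ cong (_++ applyUpTo f (i ∸ length (w n))) (w≡applyUpTo n) ⟨
      w n ++ applyUpTo f (i ∸ length (w n)) ∎)
    where
    open ≡-Reasoning
    f = λ j → quotient (length (w n) + j)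

-- Archimedean estimates

archimedean : ∀ ε → 0ℚ ℚ.< ε → ∃ λ N → ∀ n → N ≤ n → 1ℚ ℚ.< ε ℚ.* fromℕ n
archimedean ε@(mkℚ (+ zero) d _)       0<ε with () ← ℚ.positive 0<ε
archimedean ε@(mkℚ (ℤ.-[1+ _ ]) d _)   0<ε with () ← ℚ.positive 0<ε
-- Here ε = (k + 1)/(d + 1), so n > d + 1 already gives (k + 1) n > d + 1.
archimedean ε@(mkℚ (+ suc k) d _) 0<ε = suc (suc d) , λ n d<n →
  subst (λ x → 1ℚ ℚ.< ε ℚ.* x) (sym (/1≡fromℤ (+ n)))
    (ℚ.toℚᵘ-cancel-< (ℚᵘ.<-respʳ-≃ (ℚᵘ.≃-sym (ℚ.toℚᵘ-homo-* ε (fromℤ (+ n))))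
      (ℚᵘ.*<* (subst₂ ℤ._<_ (sym (ℤ.*-identityˡ (+ (suc d * 1))))
        (sym (trans (ℤ.*-identityʳ (+ suc k ℤ.* + n)) (sym (ℤ.pos-* (suc k) n))))
        (ℤ.+<+ (subst (_< suc k * n) (sym (ℕ.*-identityʳ (suc d)))
          (ℕ.≤-trans d<n (ℕ.m≤m+n n (k * n)))))))))

-- Both points lie between s₀ and s₀ + 1/A, and 1/A is below ε. Either sign of x - y is a difference
-- of two such gaps, and dropping the subtracted one only enlarges it.
within-ε : ∀ x y s₀ {ε} A → NonNegative A → 1ℚ ℚ.< ε ℚ.* A →
  0ℚ ℚ.≤ x ℚ.- s₀ → (x ℚ.- s₀) ℚ.* A ℚ.≤ 1ℚ →
  0ℚ ℚ.≤ y ℚ.- s₀ → (y ℚ.- s₀) ℚ.* A ℚ.≤ 1ℚ →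
  ℚ.∣ x ℚ.- y ∣ ℚ.< ε
within-ε x y s₀ {ε} A A≥0 1<εA 0≤x xA≤1 0≤y yA≤1 = go (ℚ.∣p∣≡p∨∣p∣≡-p (x ℚ.- y))
  where
  difference<ε : ∀ p q → 0ℚ ℚ.≤ q → p ℚ.* A ℚ.≤ 1ℚ → p ℚ.- q ℚ.< ε
  difference<ε p q 0≤q pA≤1 = ℚ.≤-<-trans
    (subst (p ℚ.- q ℚ.≤_) (ℚ.+-identityʳ p) (ℚ.+-monoʳ-≤ p (ℚ.neg-antimono-≤ 0≤q)))
    (ℚ.*-cancelʳ-<-nonNeg A {{A≥0}} (ℚ.≤-<-trans pA≤1 1<εA))
  go : ℚ.∣ x ℚ.- y ∣ ≡ x ℚ.- y ⊎ ℚ.∣ x ℚ.- y ∣ ≡ ℚ.- (x ℚ.- y) → ℚ.∣ x ℚ.- y ∣ ℚ.< ε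
  go (inj₁ eq) = subst (ℚ._< ε)
    (trans (solve 3 (λ x y s → (x :- s) :- (y :- s) := x :- y) refl x y s₀) (sym eq))
    (difference<ε (x ℚ.- s₀) (y ℚ.- s₀) 0≤y xA≤1)
  go (inj₂ eq) = subst (ℚ._< ε)
    (trans (solve 3 (λ x y s → (y :- s) :- (x :- s) := :- (x :- y)) refl x y s₀) (sym eq))
    (difference<ε (y ℚ.- s₀) (x ℚ.- s₀) 0≤x yA≤1)

-- The folded words, the Engel denominators and the partial sums

module Folding (a₀ : ℤ) (w₀ : List ℕ) (adm₀ : Admissible w₀)
  (z : ℕ → ℕ) (z≥2 : ∀ j → 2 ≤ j → 2 ≤ z j) where

  word : ℕ → List ℕ
  word zero    = w₀
  word (suc n) = foldWord (z (2 + n)) (word n)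

  2≤z : ∀ n → 2 ≤ z (2 + n)
  2≤z n = z≥2 (2 + n) (s≤s (s≤s z≤n))

  admissible : ∀ n → Admissible (word n)
  admissible zero    = adm₀
  admissible (suc n) = foldWord-admissible (z (2 + n)) (2≤z n) (admissible n)

  denominator : ℕ → ℕ
  denominator n = a₁₁ (conv (word n))

  denominator-suc : ∀ n → denominator (suc n) ≡ denominator n ^ 2 * z (2 + n)
  denominator-suc n = trans
    (fold-denominator (z (2 + n) ∸ 1) (foldsTo (word n) (admissible n)))
    (cong (denominator n ^ 2 *_) (ℕ.m+[n∸m]≡n (ℕ.≤-trans (s≤s z≤n) (2≤z n))))

  -- For d at least 1 and z at least 2, d² z is at least 2 d and hence at least d + 1. This growth
  -- makes the gaps 1/xₙ tend to 0.
  n≤denominator : ∀ n → n ≤ denominator n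
  n≤denominator zero    = z≤n
  n≤denominator (suc n) = begin
    suc n                              ≤⟨ ℕ.+-mono-≤ 1≤d (n≤denominator n) ⟩
    denominator n + denominator n      ≡⟨ cong (_+_ (denominator n)) (ℕ.+-identityʳ (denominator n)) ⟨
    2 * denominator n                  ≡⟨ ℕ.*-comm 2 (denominator n) ⟩
    denominator n * 2                  ≤⟨ ℕ.*-mono-≤ d≤d² (2≤z n) ⟩
    denominator n ^ 2 * z (2 + n)      ≡⟨ denominator-suc n ⟨
    denominator (suc n)                ∎
    where
    open ℕ.≤-Reasoning
    1≤d = 1≤conv (word n) (positive (admissible n))
    d≤d² : denominator n ≤ denominator n ^ 2
    d≤d² = ℕ.m≤m*n (denominator n) (denominator n * 1) {{>-nonZero (ℕ.*-mono-≤ 1≤d (ℕ.≤-refl {1}))}}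

  engel-denominator : ∀ n → engel (denominator 0) z n ≡ denominator n
  engel-denominator zero    = refl
  engel-denominator (suc n) =
    trans (cong (λ x → x ^ 2 * z (2 + n)) (engel-denominator n)) (sym (denominator-suc n))

  partialSum-value : ∀ n →
    partialSum (value [ a₀ ⨾ w₀ ]) (engel (denominator 0) z) n ≡ value [ a₀ ⨾ word n ]
  partialSum-value zero    = refl
  partialSum-value (suc n) = begin
    partialSum (value [ a₀ ⨾ w₀ ]) (engel (denominator 0) z) n ℚ.+
      recip (fromℕ (engel (denominator 0) z (suc n)))
      ≡⟨ cong₂ (λ s x → s ℚ.+ recip (fromℕ x)) (partialSum-value n) (engel-denominator (suc n)) ⟩
    a₀ / 1 ℚ.+ fractional (word n) ℚ.+ recip (fromℕ (denominator (suc n)))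
      ≡⟨ ℚ.+-assoc (a₀ / 1) (fractional (word n)) (recip (fromℕ (denominator (suc n)))) ⟩
    a₀ / 1 ℚ.+ (fractional (word n) ℚ.+ recip (fromℕ (denominator (suc n))))
      ≡⟨ cong (a₀ / 1 ℚ.+_) (fractional-fold (z (2 + n) ∸ 1) (foldsTo (word n) (admissible n))
           (even (admissible n)) (positive (admissible n)) (positive (admissible (suc n)))) ⟨
    value [ a₀ ⨾ word (suc n) ] ∎
    where open ≡-Reasoning

  head-++ : ∀ (u v : List ℕ) → 2 ≤ length u → head (u ++ v) ≡ head u
  head-++ (_ ∷ _) v _ = refl

  word-head : ∀ n → head (word n) ≡ head w₀
  word-head zero    = refl
  word-head (suc n) = trans (head-++ (word n) _ (long (admissible n))) (word-head n)

  φ-foldWord : ∀ b y w → (if b then φ* y [ a₀ ⨾ w ] else φ y [ a₀ ⨾ w ]) ≡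
    [ a₀ ⨾ w ++ (y ∸ 1) ∷ (if b then star w else hat w) ]
  φ-foldWord true  y w = refl
  φ-foldWord false y w = refl

  -- From the second step on `𝒞` tests a₁ and `word` the last quotient. The tests agree by
  -- `foldWord-last`, and `word-head` says that extension leaves a₁ unchanged.
  𝒞-word : ∀ n → 𝒞 [ a₀ ⨾ w₀ ] z n ≡ [ a₀ ⨾ word n ]
  𝒞-word zero          = refl
  𝒞-word (suc zero)    = φ-foldWord (does (isOne? (last w₀))) (z 2) w₀
  𝒞-word (suc (suc n)) rewrite 𝒞-word (suc n)
    | sym (trans (foldWord-last (z (2 + n)) (admissible n))
        (cong (λ m → does (isOne? m)) (word-head n))) =
    φ-foldWord (does (isOne? (last (word (suc n))))) (z (3 + n)) (word (suc n))

  open Limit a₀ word (λ n → positive (admissible n)) (λ n → _ , _ , refl) public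

  truncate-near : ∀ n {i} → length (word n) ≤ i →
    let gap = value (truncate limit i) ℚ.- value [ a₀ ⨾ word n ] in
    0ℚ ℚ.≤ gap × gap ℚ.* fromℕ (denominator n) ℚ.≤ 1ℚ
  truncate-near n {i} n≤i with v , v≢0 , eq ← truncate-beyond n n≤i =
    subst (0ℚ ℚ.≤_) (sym (gap v eq)) (fractional-++-lower (word n) v (positive adm) v≢0 (even adm)) ,
    subst (λ x → x ℚ.* fromℕ (denominator n) ℚ.≤ 1ℚ) (sym (gap v eq))
      (fractional-++-upper (word n) v (positive adm) v≢0 (even adm))
    where
    adm = admissible n
    gap : ∀ v → truncate limit i ≡ [ a₀ ⨾ word n ++ v ] →
      value (truncate limit i) ℚ.- value [ a₀ ⨾ word n ] ≡
      fractional (word n ++ v) ℚ.- fractional (word n)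
    gap v eq = trans (cong (λ c → value c ℚ.- value [ a₀ ⨾ word n ]) eq)
      (solve 3 (λ a s s₀ → (a :+ s) :- (a :+ s₀) := s :- s₀) refl
        (a₀ / 1) (fractional (word n ++ v)) (fractional (word n)))

  -- All these truncations lie at most 1/`denominator N` above the value of the N-th word. The
  -- threshold is a length, so the estimate covers the partial sums too, which are truncations at
  -- word lengths.
  truncate-cauchy : ∀ ε → 0ℚ ℚ.< ε → ∃ λ N → ∀ i j → length (word N) ≤ i → length (word N) ≤ j →
    ℚ.∣ value (truncate limit i) ℚ.- value (truncate limit j) ∣ ℚ.< ε
  truncate-cauchy ε 0<ε with N , large ← archimedean ε 0<ε = N , λ i j N≤i N≤j →
    let 0≤i , i≤1 = truncate-near N N≤i; 0≤j , j≤1 = truncate-near N N≤j in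
    within-ε (value (truncate limit i)) (value (truncate limit j)) (value [ a₀ ⨾ word N ])
      (fromℕ (denominator N)) (fromℕ-nonNeg (denominator N))
      (large (denominator N) (n≤denominator N)) 0≤i i≤1 0≤j j≤1

-- The initial word and the expansion of the series

initial-admissible : (p/q : ℚ) → (∀ (m : ℤ) → p/q ≢ m / 1) → ↧ₙ p/q ≢ 2 →
  (c : FiniteCF) → Positive c → value c ≡ p/q → 2 ∣ length (quotients c) →
  Admissible (quotients c)
initial-admissible p/q p/q∉ℤ q≢2 c@([ a₀ ⨾ w ]) w≢0 c≡p/q 2∣w = record
  { positive = w≢0
  ; even     = 2∣w
  ; long     = 2≤length w 2∣w w≢[]
  -- The word 1, 1 has continuant 2, so it would give q = 2. Its starred fold ends in 2 although a₁
  -- = 1, and the test of a₁ would then choose the wrong transformation.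
  ; notOnes  = λ w≡11 → q≢2 (trans q≡A (cong (λ u → a₁₁ (conv u)) w≡11))
  }
  where
  q≡A : ↧ₙ p/q ≡ a₁₁ (conv w)
  q≡A = trans (cong ↧ₙ_ (sym c≡p/q)) (↧ₙ-value c w≢0 2∣w)
  w≢[] : w ≢ []
  w≢[] w≡[] = p/q∉ℤ a₀ (trans (sym c≡p/q)
    (trans (cong (λ u → a₀ / 1 ℚ.+ fractional u) w≡[]) (ℚ.+-identityʳ (a₀ / 1))))
  2≤length : ∀ (u : List ℕ) → 2 ∣ length u → u ≢ [] → 2 ≤ length u
  2≤length []          _   u≢[] = ⊥-elim (u≢[] refl)
  2≤length (_ ∷ [])    2∣1 _    with () ← ∣1⇒≡1 2∣1
  2≤length (_ ∷ _ ∷ _) _   _    = s≤s (s≤s z≤n)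

theorem4p2 : (p/q : ℚ) → (∀ (m : ℤ) → p/q ≢ m / 1) → ↧ₙ p/q ≢ 2 →
    (c : FiniteCF) → Positive c → value c ≡ p/q →
    (k : ℕ) → length (quotients c) ≡ 2 * k →
    (z : ℕ → ℕ) → (∀ j → 2 ≤ j → 2 ≤ z j) →
    ∃ λ (lim : InfiniteCF) → IsLimit (𝒞 c z) lim ×
    (∃ λ (α : ℝ) → (partialSum p/q (engel (↧ₙ p/q) z) ⟶ α) × HasExpansion α lim)
theorem4p2 p/q p/q∉ℤ q≢2 c@([ a₀ ⨾ w ]) w≢0 c≡p/q k len z z≥2 =
  limit ,
  ((λ N → subst (λ x → x ≡ truncate limit (length (quotients x))) (sym (𝒞-word N)) (prefixes N)) ,
   λ i → let N , i<N = unbounded i in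
     N , subst (λ x → suc i ≤ length (quotients x)) (sym (𝒞-word N)) i<N) ,
  -- The real α is the sequence of partial sums itself.
  record { approx = s ; cauchy = s-cauchy } ,
  s-converges ,
  limit-converges
  where
  2∣w : 2 ∣ length w
  2∣w = divides k (trans len (ℕ.*-comm 2 k))

  open Folding a₀ w (initial-admissible p/q p/q∉ℤ q≢2 c w≢0 c≡p/q 2∣w) z z≥2

  prefixes : ∀ N → [ a₀ ⨾ word N ] ≡ truncate limit (length (word N))
  prefixes = proj₁ limit-isLimit

  unbounded : ∀ i → ∃ λ N → suc i ≤ length (word N)
  unbounded = proj₂ limit-isLimit

  s : ℕ → ℚ
  s = partialSum p/q (engel (↧ₙ p/q) z)

  -- This places the partial sums among the truncations of the limit, so one Cauchy estimate handles
  -- both sequences.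
  s-truncate : ∀ n → s n ≡ value (truncate limit (length (word n)))
  s-truncate n = begin
    partialSum p/q (engel (↧ₙ p/q) z) n
      ≡⟨ cong (λ r → partialSum r (engel (↧ₙ r) z) n) c≡p/q ⟨
    partialSum (value c) (engel (↧ₙ value c) z) n
      ≡⟨ cong (λ q → partialSum (value c) (engel q z) n) (↧ₙ-value c w≢0 2∣w) ⟩
    partialSum (value c) (engel (denominator 0) z) n  ≡⟨ partialSum-value n ⟩
    value [ a₀ ⨾ word n ]                             ≡⟨ cong value (prefixes n) ⟩
    value (truncate limit (length (word n)))          ∎
    where open ≡-Reasoning

  s-cauchy : IsCauchy s
  s-cauchy ε 0<ε = let N , close = truncate-cauchy ε 0<ε in N , λ m n N≤m N≤n →
    subst₂ (λ x y → ℚ.∣ x ℚ.- y ∣ ℚ.< ε) (sym (s-truncate m)) (sym (s-truncate n))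
      (close (length (word m)) (length (word n)) (length-mono N≤m) (length-mono N≤n))

  s-converges : s ⟶ record { approx = s ; cauchy = s-cauchy }
  s-converges ε 0<ε = let N , close = s-cauchy ε 0<ε in N , λ m n N≤m N≤n → close n m N≤n N≤m

  limit-converges : HasExpansion (record { approx = s ; cauchy = s-cauchy }) limit
  limit-converges ε 0<ε = let N , close = truncate-cauchy ε 0<ε in
    -- `N` bounds the index `m` of the partial sum, and `length (word N)` the length `n` of the
    -- truncation.
    N ⊔ length (word N) , λ m n bound≤m bound≤n →
    subst (λ y → ℚ.∣ value (truncate limit n) ℚ.- y ∣ ℚ.< ε) (sym (s-truncate m))
      (close n (length (word m)) (ℕ.m⊔n≤o⇒n≤o N _ bound≤n) (length-mono (ℕ.m⊔n≤o⇒m≤o N _ bound≤m)))
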